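{- Let $k\ge0$ and let $(w_1,i_1),(w_2,i_2)$ be marked words over a finite alphabet $A$. Then $(w_1,i_1)\equiv_k(w_2,i_2)$ if and only if Player 2 has a winning strategy in the $k$-round game on $(w_1,i_1)$ and $(w_2,i_2)$.
   Context: A marked word is a pair $(w,i)$ with $w\in A^*$ and $1\le i\le|w|$; $w(j)$ is the $j$-th letter. $FO^2[<,\mathrm{Inv}]$ is two-variable first-order logic with $<$, unary predicates $a(x)$ and binary predicates $a(x,y)$ meaning that some position strictly between $x$ and $y$ carries $a$. $(w_1,i_1)\equiv_k(w_2,i_2)$ means these marked words satisfy exactly the same $FO^2[<,\mathrm{Inv}]$ formulas with one free variable (interpreted at the mark) of quantifier depth at most $k$. The $k$-round game: a single pebble on each word, initially on $i_1$ and $i_2$. In each round, if the pebbles are on $j_1,j_2$, Player 1 chooses one word, say $w_1$, and moves its pebble to a position $j_1'\ne j_1$; Player 2 must move the other pebble to a position $j_2'$ with (i) $j_1<j_1'$ iff $j_2<j_2'$, (ii) $w_1(j_1')=w_2(j_2')$, (iii) the set of letters occurring strictly between $j_1$ and $j_1'$ in $w_1$ equals the set of letters occurring strictly between $j_2$ and $j_2'$ in $w_2$ (symmetrically if Player 1 chooses $w_2$). Player 2 wins the $k$-round game if $w_1(i_1)=w_2(i_2)$ and she makes a legal response in each of the $k$ rounds; otherwise Player 1 wins. -}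

module Defs where

open import Data.Fin.Base using (Fin; _<_)
open import Data.Fin.Subset using (Subset; ⁅_⁆; _∪_; _-_; _⊆_)
open import Data.List.Base using (List; length; lookup)
open import Data.Nat.Base as ℕ using (ℕ; zero; suc; _⊔_)
open import Data.Product.Base using (_×_; ∃; proj₁; proj₂)
open import Data.Sum.Base using (_⊎_; inj₁; inj₂)
open import Data.Unit.Base using (⊤)
open import Data.Vec.Functional using (Vector; updateAt)
open import Function.Base using (const)
open import Function.Bundles using (_⇔_)
open import Relation.Binary.PropositionalEquality using (_≡_; _≢_)
open import Relation.Nullary.Negation using (¬_)

private
  variable
    A : Set

Pos : List A → Set
Pos w = Fin (length w)

record MarkedWord (A : Set) : Set where
  constructor _,_
  field
    word : List A
    mark : Pos word

open MarkedWord public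

-- "Between" is symmetric in its endpoints: neither the predicate a(x,y) nor
-- the game presupposes which of the two positions comes first.
StrictlyBetween : ∀ {n} → Fin n → Fin n → Fin n → Set
StrictlyBetween i j l = (i < l × l < j) ⊎ (j < l × l < i)

OccursBetween : (w : List A) → Pos w → Pos w → A → Set
OccursBetween w i j a = ∃ λ l → StrictlyBetween i j l × lookup w l ≡ a

Var : Set
Var = Fin 2

infix  8 _≐_ _≺_
infix  7 ¬′_
infixr 6 _∧′_
infixr 5 _∨′_

data Formula (A : Set) : Set where
  _≐_ _≺_   : Var → Var → Formula A
  letter    : A → Var → Formula A
  between   : A → Var → Var → Formula A
  ¬′_       : Formula A → Formula A
  _∧′_ _∨′_ : Formula A → Formula A → Formula A
  ∃′ ∀′     : Var → Formula A → Formula A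

depth : Formula A → ℕ
depth (u ≐ v)         = 0
depth (u ≺ v)         = 0
depth (letter a v)    = 0
depth (between a u v) = 0
depth (¬′ φ)          = depth φ
depth (φ ∧′ ψ)        = depth φ ⊔ depth ψ
depth (φ ∨′ ψ)        = depth φ ⊔ depth ψ
depth (∃′ v φ)        = suc (depth φ)
depth (∀′ v φ)        = suc (depth φ)

free : Formula A → Subset 2
free (u ≐ v)         = ⁅ u ⁆ ∪ ⁅ v ⁆
free (u ≺ v)         = ⁅ u ⁆ ∪ ⁅ v ⁆
free (letter a v)    = ⁅ v ⁆
free (between a u v) = ⁅ u ⁆ ∪ ⁅ v ⁆
free (¬′ φ)          = free φ
free (φ ∧′ ψ)        = free φ ∪ free ψ
free (φ ∨′ ψ)        = free φ ∪ free ψ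
free (∃′ v φ)        = free φ - v
free (∀′ v φ)        = free φ - v

infix 4 _[_]⊨_ _⊨_

_[_]⊨_ : (w : List A) → Vector (Pos w) 2 → Formula A → Set
w [ σ ]⊨ u ≐ v         = σ u ≡ σ v
w [ σ ]⊨ u ≺ v         = σ u < σ v
w [ σ ]⊨ letter a v    = lookup w (σ v) ≡ a
w [ σ ]⊨ between a u v = OccursBetween w (σ u) (σ v) a
w [ σ ]⊨ ¬′ φ          = ¬ (w [ σ ]⊨ φ)
w [ σ ]⊨ φ ∧′ ψ        = (w [ σ ]⊨ φ) × (w [ σ ]⊨ ψ)
w [ σ ]⊨ φ ∨′ ψ        = (w [ σ ]⊨ φ) ⊎ (w [ σ ]⊨ ψ)
w [ σ ]⊨ ∃′ v φ        = ∃ λ j → w [ updateAt σ v (const j) ]⊨ φ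
w [ σ ]⊨ ∀′ v φ        = ∀ j → w [ updateAt σ v (const j) ]⊨ φ

-- Used only for φ with at most one free variable: that variable denotes the
-- mark, and the value given to the other one is irrelevant.
_⊨_ : MarkedWord A → Formula A → Set
(w , i) ⊨ φ = w [ const i ]⊨ φ

infix 4 _≡[_]_

_≡[_]_ : MarkedWord A → ℕ → MarkedWord A → Set
_≡[_]_ {A} M₁ k M₂ =
  (v : Var) (φ : Formula A) → free φ ⊆ ⁅ v ⁆ → depth φ ℕ.≤ k →
  (M₁ ⊨ φ) ⇔ (M₂ ⊨ φ)

-- Player 1 has moved the pebble on w from j to j′; Player 2 answers on v by
-- moving from l to l′.  Her pebble too has to move: `order` alone would let
-- it stay put whenever j′ < j.
record LegalReply (w v : List A) (j j′ : Pos w) (l l′ : Pos v) : Set where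
  field
    moves   : l′ ≢ l
    order   : (j < j′) ⇔ (l < l′)
    label   : lookup w j′ ≡ lookup v l′
    letters : ∀ a → OccursBetween w j j′ a ⇔ OccursBetween v l l′ a

module Game {A : Set} (w₁ w₂ : List A) where

  -- Player 1 picks a word and a new position in it.
  Move : Set
  Move = Pos w₁ ⊎ Pos w₂

  Reply : Move → Set
  Reply (inj₁ _) = Pos w₂
  Reply (inj₂ _) = Pos w₁

  -- A reply as a function of all Player 1's moves so far.  It is also defined
  -- on illegal moves, where `Winning` ignores it.
  Strategy : ℕ → Set
  Strategy zero    = ⊤
  Strategy (suc k) = (m : Move) → Reply m × Strategy k

  Winning : (k : ℕ) → Strategy k → Pos w₁ → Pos w₂ → Set
  Winning zero    _ j₁ j₂ = ⊤
  Winning (suc k) s j₁ j₂ =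
    (∀ j₁′ → j₁′ ≢ j₁ →
       let j₂′ = proj₁ (s (inj₁ j₁′)) in
       LegalReply w₁ w₂ j₁ j₁′ j₂ j₂′ × Winning k (proj₂ (s (inj₁ j₁′))) j₁′ j₂′)
    ×
    (∀ j₂′ → j₂′ ≢ j₂ →
       let j₁′ = proj₁ (s (inj₂ j₂′)) in
       LegalReply w₂ w₁ j₂ j₂′ j₁ j₁′ × Winning k (proj₂ (s (inj₂ j₂′))) j₁′ j₂′)

Player2Wins : ℕ → MarkedWord A → MarkedWord A → Set
Player2Wins k (w₁ , i₁) (w₂ , i₂) =
  lookup w₁ i₁ ≡ lookup w₂ i₂ × ∃ λ (s : Strategy k) → Winning k s i₁ i₂
  where open Game w₁ w₂

{-# OPTIONS --safe #-}

-- Every marked word (w , i) has a Hintikka formula of depth k, built from the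
-- Hintikka formulas of depth k - 1 of w with the mark moved.  A proof that
-- another marked word satisfies it already contains Player 2's replies, as
-- witnesses of ∃ and as choices of disjuncts under ∀, so no argument by
-- contradiction is needed.  In the other direction, formulas are compared
-- under assignments to both variables, with a back-and-forth relation holding
-- at each of the two variables separately: a quantifier rebinds one variable,
-- and the pebble is moved away from the position of the other one.
module Submission where

open import Defs
open import Data.Empty using (⊥-elim)
open import Data.Fin.Base using (Fin; _<_; opposite)
open import Data.Fin.Patterns using (0F; 1F)
open import Data.Fin.Properties using (_≟_; _<?_; <-cmp; <-irrefl; <-asym; any?)
open import Data.Fin.Subset using (Subset; _∪_; _-_; _⊆_; ⁅_⁆)
open import Data.Fin.Subset.Properties using (x∈⁅x⁆; x∈p∪q⁻)
open import Data.List.Base using (List; lookup)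
open import Data.Nat.Base as ℕ using (ℕ; zero; suc; z≤n; s≤s)
open import Data.Nat.Properties using (⊔-lub; m⊔n≤o⇒m≤o; m⊔n≤o⇒n≤o)
open import Data.Product.Base as Product using (_×_; _,_; ∃; proj₁; proj₂)
open import Data.Sum.Base as Sum using (_⊎_; inj₁; inj₂)
open import Data.Unit.Base using (tt)
open import Data.Vec.Base using (_∷_; []; here; there)
open import Data.Vec.Functional using (Vector; foldr; updateAt)
open import Data.Vec.Functional.Properties using (updateAt-updates; updateAt-minimal)
open import Function.Base using (_∘_; const; id)
open import Function.Bundles using (_⇔_; _↔_; mk⇔; Equivalence; Inverse)
open import Function.Construct.Composition using (_⇔-∘_)
open import Function.Construct.Identity using (⇔-id)
open import Function.Construct.Symmetry using (⇔-sym)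
open import Function.Properties.Inverse using (↔⇒↣)
open import Relation.Binary.Definitions using (DecidableEquality; tri<; tri≈; tri>)
open import Relation.Binary.PropositionalEquality
  using (_≡_; _≢_; refl; sym; subst; subst₂)
open import Relation.Nullary.Decidable using (Dec; yes; no; via-injection; _×-dec_; _⊎-dec_)
open import Relation.Nullary.Negation using (contradiction)

open Equivalence using (to; from)

private
  variable
    A P : Set
    k : ℕ
    w v : List A

-- Aligned pairs of positions and the back-and-forth relation

record Aligned (w v : List A) (i j : Pos w) (i′ j′ : Pos v) : Set where
  field
    equal   : (i ≡ j) ⇔ (i′ ≡ j′)
    order   : (i < j) ⇔ (i′ < j′)
    letters : ∀ a → OccursBetween w i j a ⇔ OccursBetween v i′ j′ a

open Aligned

aligned-id : ∀ {i j : Pos w} → Aligned w w i j i j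
aligned-id .equal     = ⇔-id _
aligned-id .order     = ⇔-id _
aligned-id .letters a = ⇔-id _

aligned-sym : ∀ {i j : Pos w} {i′ j′ : Pos v} →
              Aligned w v i j i′ j′ → Aligned v w i′ j′ i j
aligned-sym a .equal     = ⇔-sym (a .equal)
aligned-sym a .order     = ⇔-sym (a .order)
aligned-sym a .letters b = ⇔-sym (a .letters b)

occursBetween-swap : ∀ {i j : Pos w} {a} → OccursBetween w i j a → OccursBetween w j i a
occursBetween-swap (l , i-l-j , eq) = l , Sum.swap i-l-j , eq

-- Trichotomy in `v`: the other two cases are reflected back to `w` by `order` and `equal`. So these
-- two fields fix the whole order type, and alignment survives swapping the endpoints.
aligned-> : ∀ {i j : Pos w} {i′ j′ : Pos v} → Aligned w v i j i′ j′ → j < i → j′ < i′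
aligned-> {i′ = i′} {j′} a j<i with <-cmp i′ j′
... | tri< i′<j′ _ _ = contradiction (from (a .order) i′<j′) (<-asym j<i)
... | tri≈ _ i′≡j′ _ = ⊥-elim (<-irrefl (sym (from (a .equal) i′≡j′)) j<i)
... | tri> _ _ j′<i′ = j′<i′

aligned-swap : ∀ {i j : Pos w} {i′ j′ : Pos v} →
               Aligned w v i j i′ j′ → Aligned w v j i j′ i′
aligned-swap a .equal     = mk⇔ (sym ∘ to (a .equal) ∘ sym) (sym ∘ from (a .equal) ∘ sym)
aligned-swap a .order     = mk⇔ (aligned-> a) (aligned-> (aligned-sym a))
aligned-swap {w = w} {v = v} a .letters b = mk⇔
  (occursBetween-swap {w = v} ∘ to (a .letters b) ∘ occursBetween-swap {w = w})
  (occursBetween-swap {w = w} ∘ from (a .letters b) ∘ occursBetween-swap {w = v})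

¬occursBetween-diagonal : ∀ {i : Pos w} {a} → OccursBetween w i i a → P
¬occursBetween-diagonal (l , inj₁ (i<l , l<i) , _) = contradiction l<i (<-asym i<l)
¬occursBetween-diagonal (l , inj₂ (i<l , l<i) , _) = contradiction l<i (<-asym i<l)

-- Nothing lies strictly between a position and itself. This covers pebbles that stay put and atoms
-- that repeat a variable.
aligned-diagonal : ∀ {i : Pos w} {i′ : Pos v} → Aligned w v i i i′ i′
aligned-diagonal .equal     = mk⇔ (const refl) (const refl)
aligned-diagonal {i = i} {i′} .order =
  mk⇔ (⊥-elim ∘ <-irrefl {x = i} refl) (⊥-elim ∘ <-irrefl {x = i′} refl)
aligned-diagonal {w = w} {v = v} .letters a =
  mk⇔ (¬occursBetween-diagonal {w = w}) (¬occursBetween-diagonal {w = v})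

-- Unlike in the game, a pebble may stay put, and then so must the other one:
-- quantifiers range over all positions.
BackAndForth : (w v : List A) → ℕ → Pos w → Pos v → Set
BackAndForth w v zero    i i′ = lookup w i ≡ lookup v i′
BackAndForth w v (suc k) i i′ =
  lookup w i ≡ lookup v i′ ×
  (∀ j → ∃ λ j′ → Aligned w v i j i′ j′ × BackAndForth w v k j j′) ×
  (∀ j′ → ∃ λ j → Aligned w v i j i′ j′ × BackAndForth w v k j j′)

backAndForth-label : ∀ k {i : Pos w} {i′ : Pos v} →
                     BackAndForth w v k i i′ → lookup w i ≡ lookup v i′
backAndForth-label zero    eq       = eq
backAndForth-label (suc k) (eq , _) = eq

backAndForth-sym : ∀ k {i : Pos w} {i′ : Pos v} →
                   BackAndForth w v k i i′ → BackAndForth v w k i′ i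
backAndForth-sym zero    eq                  = sym eq
backAndForth-sym (suc k) (eq , forth , back) =
  sym eq ,
  Product.map₂ (Product.map aligned-sym (backAndForth-sym k)) ∘ back ,
  Product.map₂ (Product.map aligned-sym (backAndForth-sym k)) ∘ forth

-- The same answers work at every level. A quantifier lowers the level, also at the variable that it
-- does not rebind.
backAndForth-pred : ∀ k {i : Pos w} {i′ : Pos v} →
                    BackAndForth w v (suc k) i i′ → BackAndForth w v k i i′
backAndForth-pred zero    (eq , _)            = eq
backAndForth-pred (suc k) (eq , forth , back) =
  eq ,
  Product.map₂ (Product.map₂ (backAndForth-pred k)) ∘ forth ,
  Product.map₂ (Product.map₂ (backAndForth-pred k)) ∘ back

-- Strategies

legalReply⇒aligned : ∀ {j j′ : Pos w} {l l′ : Pos v} →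
                     j′ ≢ j → LegalReply w v j j′ l l′ → Aligned w v j j′ l l′
legalReply⇒aligned j′≢j r .equal   =
  mk⇔ (⊥-elim ∘ j′≢j ∘ sym) (⊥-elim ∘ LegalReply.moves r ∘ sym)
legalReply⇒aligned j′≢j r .order   = LegalReply.order r
legalReply⇒aligned j′≢j r .letters = LegalReply.letters r

aligned⇒legalReply : ∀ {j j′ : Pos w} {l l′ : Pos v} →
                     j′ ≢ j → lookup w j′ ≡ lookup v l′ →
                     Aligned w v j j′ l l′ → LegalReply w v j j′ l l′
aligned⇒legalReply j′≢j eq a = record
  { moves   = j′≢j ∘ sym ∘ from (a .equal) ∘ sym
  ; order   = a .order
  ; label   = eq
  ; letters = a .letters
  }

module _ {w v : List A} where
  open Game w v

  truncate : ∀ k → Strategy (suc k) → Strategy k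
  truncate zero    s   = tt
  truncate (suc k) s m = proj₁ (s m) , truncate k (proj₂ (s m))

  winning-truncate : ∀ k (s : Strategy (suc k)) {i i′} →
                     Winning (suc k) s i i′ → Winning k (truncate k s) i i′
  winning-truncate zero    s _             = tt
  winning-truncate (suc k) s (win₁ , win₂) =
    (λ j j≢i → Product.map₂ (winning-truncate k _) (win₁ j j≢i)) ,
    (λ j′ j′≢i′ → Product.map₂ (winning-truncate k _) (win₂ j′ j′≢i′))

  winning⇒backAndForth : ∀ k (s : Strategy k) {i i′} → lookup w i ≡ lookup v i′ →
                         Winning k s i i′ → BackAndForth w v k i i′
  winning⇒backAndForth zero    s eq _ = eq
  winning⇒backAndForth (suc k) s {i} {i′} eq win@(win₁ , win₂) = eq , forth , back
    where
    -- The case `j ≡ i` is not a move of the game. The other pebble stays as well, and a strategy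
    -- for one round fewer covers the remaining level.
    stay : BackAndForth w v k i i′
    stay = winning⇒backAndForth k (truncate k s) eq (winning-truncate k s win)

    forth : ∀ j → ∃ λ j′ → Aligned w v i j i′ j′ × BackAndForth w v k j j′
    forth j with j ≟ i
    ... | yes refl = i′ , aligned-diagonal , stay
    ... | no j≢i   = let legal , next = win₁ j j≢i in
      _ , legalReply⇒aligned j≢i legal ,
      winning⇒backAndForth k _ (LegalReply.label legal) next

    back : ∀ j′ → ∃ λ j → Aligned w v i j i′ j′ × BackAndForth w v k j j′
    back j′ with j′ ≟ i′
    ... | yes refl = i , aligned-diagonal , stay
    ... | no j′≢i′ = let legal , next = win₂ j′ j′≢i′ in
      _ , aligned-sym (legalReply⇒aligned j′≢i′ legal) ,
      winning⇒backAndForth k _ (sym (LegalReply.label legal)) next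

  -- The answers are read off the proof of the relation, which answers every position, so illegal
  -- moves of Player 1 get a reply too.
  strategy : ∀ k {i i′} → BackAndForth w v k i i′ → Strategy k
  strategy zero    _                = tt
  strategy (suc k) (_ , forth , _) (inj₁ j) =
    let j′ , _ , next = forth j in j′ , strategy k next
  strategy (suc k) (_ , _ , back) (inj₂ j′) =
    let j , _ , next = back j′ in j , strategy k next

  strategy-winning : ∀ k {i i′} (bf : BackAndForth w v k i i′) →
                     Winning k (strategy k bf) i i′
  strategy-winning zero    _                  = tt
  strategy-winning (suc k) (_ , forth , back) =
    (λ j j≢i → let _ , a , next = forth j in
      aligned⇒legalReply j≢i (backAndForth-label k next) a ,
      strategy-winning k next) ,
    (λ j′ j′≢i′ → let _ , a , next = back j′ in
      aligned⇒legalReply j′≢i′ (sym (backAndForth-label k next)) (aligned-sym a) ,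
      strategy-winning k next)

backAndForth⇔player2Wins : ∀ k {i : Pos w} {i′ : Pos v} →
  BackAndForth w v k i i′ ⇔ Player2Wins k (w , i) (v , i′)
backAndForth⇔player2Wins k = mk⇔
  (λ bf → backAndForth-label k bf , strategy k bf , strategy-winning k bf)
  (λ (eq , s , win) → winning⇒backAndForth k s eq win)

-- Preservation of formulas

-- The invariant of the induction on formulas: `pair` decides the binary atoms, `each` the letters,
-- and `each` also answers the quantifiers.
record Matching (w v : List A) (k : ℕ) (σ : Vector (Pos w) 2) (τ : Vector (Pos v) 2) : Set where
  constructor matching
  field
    pair : Aligned w v (σ 0F) (σ 1F) (τ 0F) (τ 1F)
    each : ∀ x → BackAndForth w v k (σ x) (τ x)

open Matching

matching-sym : ∀ {σ : Vector (Pos w) 2} {τ : Vector (Pos v) 2} →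
               Matching w v k σ τ → Matching v w k τ σ
matching-sym m .pair           = aligned-sym (m .pair)
matching-sym {k = k} m .each x = backAndForth-sym k (m .each x)

matching-aligned : ∀ {σ : Vector (Pos w) 2} {τ : Vector (Pos v) 2} →
                   Matching w v k σ τ → ∀ x y →
                   Aligned w v (σ x) (σ y) (τ x) (τ y)
matching-aligned m 0F 0F = aligned-diagonal
matching-aligned m 0F 1F = m .pair
matching-aligned m 1F 0F = aligned-swap (m .pair)
matching-aligned m 1F 1F = aligned-diagonal

-- Rebinding `x` discards its old value, so the new position is seen as a move away from the other
-- variable, whose back-and-forth property supplies the answer.
matching-extend : ∀ {σ : Vector (Pos w) 2} {τ : Vector (Pos v) 2} →
  Matching w v (suc k) σ τ → ∀ x j →
  ∃ λ j′ → Matching w v k (updateAt σ x (const j)) (updateAt τ x (const j′))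
matching-extend {k = k} m 0F j with m .each 1F
... | bf@(_ , forth , _) with forth j
... | j′ , a , next = j′ , λ where
  -- The answer is aligned starting from `1F`, while `pair` lists `0F` first.
  .pair    → aligned-swap a
  .each 0F → next
  .each 1F → backAndForth-pred k bf
matching-extend {k = k} m 1F j with m .each 0F
... | bf@(_ , forth , _) with forth j
... | j′ , a , next = j′ , λ where
  .pair    → a
  .each 0F → backAndForth-pred k bf
  .each 1F → next

-- Induction on `φ`. One direction is enough because a matching can be reversed, which is what
-- negation and the universal quantifier use.
⊨-transfer : ∀ {σ : Vector (Pos w) 2} {τ : Vector (Pos v) 2} →
             (φ : Formula A) → depth φ ℕ.≤ k → Matching w v k σ τ →
             w [ σ ]⊨ φ → v [ τ ]⊨ φ
⊨-transfer (x ≐ y)         _ m = to (matching-aligned m x y .equal)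
⊨-transfer (x ≺ y)         _ m = to (matching-aligned m x y .order)
⊨-transfer {k = k} (letter a x) _ m eq =
  subst (_≡ a) (backAndForth-label k (m .each x)) eq
⊨-transfer (between a x y) _ m = to (matching-aligned m x y .letters a)
⊨-transfer (¬′ φ) d m ¬sat sat = ¬sat (⊨-transfer φ d (matching-sym m) sat)
⊨-transfer (φ ∧′ ψ) d m = Product.map
  (⊨-transfer φ (m⊔n≤o⇒m≤o (depth φ) (depth ψ) d) m)
  (⊨-transfer ψ (m⊔n≤o⇒n≤o (depth φ) (depth ψ) d) m)
⊨-transfer (φ ∨′ ψ) d m = Sum.map
  (⊨-transfer φ (m⊔n≤o⇒m≤o (depth φ) (depth ψ) d) m)
  (⊨-transfer ψ (m⊔n≤o⇒n≤o (depth φ) (depth ψ) d) m)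
⊨-transfer (∃′ x φ) (s≤s d) m (j , sat) =
  let j′ , m′ = matching-extend m x j in j′ , ⊨-transfer φ d m′ sat
⊨-transfer (∀′ x φ) (s≤s d) m sat j′ =
  let j , m′ = matching-extend (matching-sym m) x j′ in
  ⊨-transfer φ d (matching-sym m′) (sat j)

backAndForth⇒≡ : ∀ {i : Pos w} {i′ : Pos v} →
                 BackAndForth w v k i i′ → (w , i) ≡[ k ] (v , i′)
backAndForth⇒≡ {w = w} {v = v} {k = k} {i} {i′} bf x φ _ d =
  mk⇔ (⊨-transfer φ d both) (⊨-transfer φ d (matching-sym both))
  where
  both : Matching w v k (const i) (const i′)
  both = matching aligned-diagonal (const bf)

-- Hintikka formulas

-- Formulas have no constant for truth, so the fold ends in a conjunct `φ` of its own; likewise for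
-- disjunctions and falsity below.
⊨-⋀ : ∀ {m σ} (φ : Formula A) (ψ : Vector (Formula A) m) →
      w [ σ ]⊨ foldr _∧′_ φ ψ ⇔ (w [ σ ]⊨ φ × ∀ j → w [ σ ]⊨ ψ j)
⊨-⋀ {m = zero}  φ ψ = mk⇔ (_, λ ()) proj₁
⊨-⋀ {m = suc m} φ ψ = mk⇔
  (λ (p , rest) → let q , ps = to (⊨-⋀ φ (ψ ∘ Fin.suc)) rest in
    q , λ { 0F → p ; (Fin.suc j) → ps j })
  (λ (q , ps) → ps 0F , from (⊨-⋀ φ (ψ ∘ Fin.suc)) (q , ps ∘ Fin.suc))

⊨-⋁ : ∀ {m σ} (φ : Formula A) (ψ : Vector (Formula A) m) →
      w [ σ ]⊨ foldr _∨′_ φ ψ ⇔ (w [ σ ]⊨ φ ⊎ ∃ λ j → w [ σ ]⊨ ψ j)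
⊨-⋁ {m = zero}  φ ψ = mk⇔ inj₁ λ { (inj₁ p) → p ; (inj₂ (() , _)) }
⊨-⋁ {m = suc m} φ ψ = mk⇔
  (λ { (inj₁ p)    → inj₂ (0F , p)
     ; (inj₂ rest) → Sum.map₂ (Product.map Fin.suc id) (to (⊨-⋁ φ (ψ ∘ Fin.suc)) rest) })
  (λ { (inj₁ q)              → inj₂ (from (⊨-⋁ φ (ψ ∘ Fin.suc)) (inj₁ q))
     ; (inj₂ (0F , p))        → inj₁ p
     ; (inj₂ (Fin.suc j , p)) → inj₂ (from (⊨-⋁ φ (ψ ∘ Fin.suc)) (inj₂ (j , p))) })

foldr-preserves : ∀ {a p m} {B : Set a} (Q : B → Set p) (_∙_ : B → B → B) →
                  (∀ x y → Q x → Q y → Q (x ∙ y)) → ∀ e (f : Vector B m) →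
                  Q e → (∀ j → Q (f j)) → Q (foldr _∙_ e f)
foldr-preserves {m = zero}  Q _∙_ pres e f qe qf = qe
foldr-preserves {m = suc m} Q _∙_ pres e f qe qf =
  pres _ _ (qf 0F) (foldr-preserves Q _∙_ pres e (f ∘ Fin.suc) qe (qf ∘ Fin.suc))

-- `P` will be a fact about one fixed word, and the literal is then evaluated in another word, where
-- it says that `φ` has the truth value of `P`.
literal : Dec P → Formula A → Formula A
literal (yes _) φ = φ
literal (no _)  φ = ¬′ φ

⊨-literal : ∀ {σ} (P? : Dec P) {φ : Formula A} →
            w [ σ ]⊨ literal P? φ ⇔ (P ⇔ w [ σ ]⊨ φ)
⊨-literal (yes p) = mk⇔ (λ sat → mk⇔ (const sat) (const p)) (λ e → to e p)
⊨-literal (no ¬p) =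
  mk⇔ (λ ¬sat → mk⇔ (⊥-elim ∘ ¬p) (⊥-elim ∘ ¬sat)) (λ e sat → ¬p (from e sat))

depth-literal : (P? : Dec P) (φ : Formula A) → depth φ ℕ.≤ k → depth (literal P? φ) ℕ.≤ k
depth-literal (yes _) φ d = d
depth-literal (no _)  φ d = d

opposite-≢ : (x : Var) → x ≢ opposite x
opposite-≢ 0F ()
opposite-≢ 1F ()

p-opposite⊆⁅x⁆ : ∀ p (x : Var) → p - opposite x ⊆ ⁅ x ⁆
p-opposite⊆⁅x⁆ (_ ∷ _ ∷ []) 0F {0F} _             = x∈⁅x⁆ 0F
p-opposite⊆⁅x⁆ (_ ∷ _ ∷ []) 1F {1F} _             = x∈⁅x⁆ 1F
p-opposite⊆⁅x⁆ (_ ∷ _ ∷ []) 0F {1F} (there ())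
p-opposite⊆⁅x⁆ (_ ∷ _ ∷ []) 1F {0F} ()

∪-lub : ∀ {m} (p q : Subset m) {r} → p ⊆ r → q ⊆ r → p ∪ q ⊆ r
∪-lub p q p⊆r q⊆r = Sum.[ p⊆r , q⊆r ] ∘ x∈p∪q⁻ p q

-- The finiteness of the alphabet enters twice: it makes equality of letters, and so
-- `OccursBetween`, decidable, and it bounds the conjunction over all letters in `alignment`.
module Hintikka {n : ℕ} (A↔Fin : A ↔ Fin n) (w : List A) where

  private
    module A↔Fin = Inverse A↔Fin

  _≟ᴬ_ : DecidableEquality A
  _≟ᴬ_ = via-injection (↔⇒↣ A↔Fin) _≟_

  occursBetween? : ∀ i j a → Dec (OccursBetween w i j a)
  occursBetween? i j a = any? λ l →
    ((i <? l ×-dec l <? j) ⊎-dec (j <? l ×-dec l <? i)) ×-dec (lookup w l ≟ᴬ a)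

  orderType : Var → Pos w → Pos w → Formula A
  orderType x i j =
    literal (i ≟ j) (x ≐ opposite x) ∧′ literal (i <? j) (x ≺ opposite x)

  occurrence : Var → Pos w → Pos w → Fin n → Formula A
  occurrence x i j c = literal (occursBetween? i j a) (between a x (opposite x))
    where a = A↔Fin.from c

  alignment : Var → Pos w → Pos w → Formula A
  alignment x i j = foldr _∧′_ (orderType x i j) (occurrence x i j)

  ⊨-alignment : ∀ x i j {v} {τ : Vector (Pos v) 2} →
    v [ τ ]⊨ alignment x i j ⇔ Aligned w v i j (τ x) (τ (opposite x))
  ⊨-alignment x i j {v} {τ} = mk⇔ sound complete
    where
    sound : v [ τ ]⊨ alignment x i j → Aligned w v i j (τ x) (τ (opposite x))
    sound sat with to (⊨-⋀ (orderType x i j) (occurrence x i j)) sat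
    ... | (eq , lt) , occ = λ where
      .equal     → to (⊨-literal (i ≟ j)) eq
      .order     → to (⊨-literal (i <? j)) lt
      -- The conjuncts are indexed by `Fin n`; the one for `a` mentions the decoding of the code of
      -- `a`.
      .letters a → subst
        (λ b → OccursBetween w i j b ⇔ OccursBetween v (τ x) (τ (opposite x)) b)
        (A↔Fin.strictlyInverseʳ a)
        (to (⊨-literal (occursBetween? i j _)) (occ (A↔Fin.to a)))

    complete : Aligned w v i j (τ x) (τ (opposite x)) → v [ τ ]⊨ alignment x i j
    complete a = from (⊨-⋀ (orderType x i j) (occurrence x i j))
      ( (from (⊨-literal (i ≟ j)) (a .equal) , from (⊨-literal (i <? j)) (a .order))
      , λ c → from (⊨-literal (occursBetween? i j _)) (a .letters (A↔Fin.from c)))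

  depth-alignment : ∀ x i j → depth (alignment x i j) ℕ.≤ k
  depth-alignment {k} x i j =
    foldr-preserves (λ φ → depth φ ℕ.≤ k) _∧′_ (λ _ _ → ⊔-lub)
      (orderType x i j) (occurrence x i j)
      (⊔-lub (depth-literal (i ≟ j) (x ≐ opposite x) z≤n)
             (depth-literal (i <? j) (x ≺ opposite x) z≤n))
      (λ c → depth-literal (occursBetween? i j (A↔Fin.from c)) (between _ x (opposite x)) z≤n)

  -- `exists` expresses the forth condition for one `j`, `forAll` the back condition. The two
  -- variables exchange roles at each level: the new position is named by `opposite x`, and the next
  -- level is free to rebind `x`.
  hintikka  : ℕ → Var → Pos w → Formula A
  neighbour : ℕ → Var → Pos w → Pos w → Formula A
  forAll    : ℕ → Var → Pos w → Formula A
  exists    : ℕ → Var → Pos w → Pos w → Formula A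

  hintikka zero    x i = letter (lookup w i) x
  hintikka (suc k) x i = foldr _∧′_ (letter (lookup w i) x ∧′ forAll k x i) (exists k x i)

  neighbour k x i j = alignment x i j ∧′ hintikka k (opposite x) j

  -- `¬′ x ≐ x` stands for falsity, closing the disjunction over the positions of `w`.
  forAll k x i   = ∀′ (opposite x) (foldr _∨′_ (¬′ x ≐ x) (neighbour k x i))
  exists k x i j = ∃′ (opposite x) (neighbour k x i j)

  depth-hintikka  : ∀ k x i → depth (hintikka k x i) ℕ.≤ k
  depth-neighbour : ∀ k x i j → depth (neighbour k x i j) ℕ.≤ k

  depth-hintikka zero    x i = z≤n
  depth-hintikka (suc k) x i =
    foldr-preserves (λ φ → depth φ ℕ.≤ suc k) _∧′_ (λ _ _ → ⊔-lub)
      (letter (lookup w i) x ∧′ forAll k x i) (exists k x i)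
      (s≤s (foldr-preserves (λ φ → depth φ ℕ.≤ k) _∨′_ (λ _ _ → ⊔-lub)
        (¬′ x ≐ x) (neighbour k x i) z≤n (depth-neighbour k x i)))
      (λ j → s≤s (depth-neighbour k x i j))

  depth-neighbour k x i j =
    ⊔-lub (depth-alignment x i j) (depth-hintikka k (opposite x) j)

  free-hintikka : ∀ k x i → free (hintikka k x i) ⊆ ⁅ x ⁆
  free-hintikka zero    x i = id
  free-hintikka (suc k) x i =
    foldr-preserves (λ φ → free φ ⊆ ⁅ x ⁆) _∧′_ (λ φ ψ → ∪-lub (free φ) (free ψ))
      (letter (lookup w i) x ∧′ forAll k x i) (exists k x i)
      (∪-lub ⁅ x ⁆ (free (forAll k x i)) id (p-opposite⊆⁅x⁆ _ x))
      (λ j → p-opposite⊆⁅x⁆ (free (neighbour k x i j)) x)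

  -- Within `w` itself every move is answered by copying it.
  ⊨-hintikka : ∀ k x (σ : Vector (Pos w) 2) → w [ σ ]⊨ hintikka k x (σ x)
  ⊨-hintikka zero    x σ = refl
  ⊨-hintikka (suc k) x σ = from (⊨-⋀ (letter _ x ∧′ forAll k x (σ x)) (exists k x (σ x)))
    ( (refl , λ j → from (⊨-⋁ (¬′ x ≐ x) (neighbour k x (σ x))) (inj₂ (j , ⊨-neighbour j)))
    , λ j → j , ⊨-neighbour j)
    where
    y = opposite x

    ⊨-neighbour : ∀ j → w [ updateAt σ y (const j) ]⊨ neighbour k x (σ x) j
    -- For a variable `x`, the values `σ′ x` and `σ′ y` equal `σ x` and `j` only propositionally.
    ⊨-neighbour j = subst₂ (λ i j → w [ σ′ ]⊨ neighbour k x i j)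
      (updateAt-minimal x y σ (opposite-≢ x)) (updateAt-updates y σ)
      (from (⊨-alignment x (σ′ x) (σ′ y)) aligned-id , ⊨-hintikka k y σ′)
      where
      σ′ = updateAt σ y (const j)

  hintikka⇒backAndForth : ∀ k x i {v} (τ : Vector (Pos v) 2) →
                          v [ τ ]⊨ hintikka k x i → BackAndForth w v k i (τ x)
  hintikka⇒backAndForth zero    x i     τ eq  = sym eq
  hintikka⇒backAndForth (suc k) x i {v} τ sat
    with to (⊨-⋀ (letter (lookup w i) x ∧′ forAll k x i) (exists k x i)) sat
  ... | (eq , all) , each =
    sym eq ,
    (λ j → Product.map₂ neighbour⇒ (each j)) ,
    back
    where
    y = opposite x

    neighbour⇒ : ∀ {j j′} → v [ updateAt τ y (const j′) ]⊨ neighbour k x i j →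
                 Aligned w v i j (τ x) j′ × BackAndForth w v k j j′
    neighbour⇒ {j} {j′} (a , h) =
      subst₂ (λ p q → Aligned w v i j p q × BackAndForth w v k j q)
        (updateAt-minimal x y τ (opposite-≢ x)) (updateAt-updates y τ)
        (to (⊨-alignment x i j) a , hintikka⇒backAndForth k y j _ h)

    back : ∀ j′ → ∃ λ j → Aligned w v i j (τ x) j′ × BackAndForth w v k j j′
    back j′ with to (⊨-⋁ (¬′ x ≐ x) (neighbour k x i)) (all j′)
    ... | inj₁ ≢         = contradiction refl ≢
    ... | inj₂ (j , nbr) = j , neighbour⇒ nbr

-- The Hintikka formula of depth `k` of `(w , i)` holds at its own mark, so the hypothesis carries
-- it over to `(v , i′)`.
≡⇒backAndForth : ∀ {A : Set} {n} {w v : List A} → A ↔ Fin n → ∀ k {i : Pos w} {i′ : Pos v} →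
                 (w , i) ≡[ k ] (v , i′) → BackAndForth w v k i i′
≡⇒backAndForth {w = w} A↔Fin k {i} {i′} eq =
  hintikka⇒backAndForth k 0F i (const i′)
    (to (eq 0F (hintikka k 0F i) (free-hintikka k 0F i) (depth-hintikka k 0F i))
      (⊨-hintikka k 0F (const i)))
  where open Hintikka A↔Fin w

theorem9 : {A : Set} {n : ℕ} → A ↔ Fin n →
    (k : ℕ) (M₁ M₂ : MarkedWord A) →
    (M₁ ≡[ k ] M₂) ⇔ Player2Wins k M₁ M₂
theorem9 A↔Fin k M₁ M₂ =
  backAndForth⇔player2Wins k ⇔-∘ mk⇔ (≡⇒backAndForth A↔Fin k) backAndForth⇒≡
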